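{- Let $\mathcal{A}=(Q,T)$ be a strongly connected $d$-dimensional VASS. Then $\mathcal{A}$ is terminating with $\mathcal{L}(n)\in\mathcal{O}(n)$ (i.e., $\mathcal{A}$ has linear termination complexity) if and only if there exists a ranking function for $\mathcal{A}$.
   Context: A $d$-dimensional VASS is a pair $\mathcal{A}=(Q,T)$ where $Q$ is a finite nonempty set of states and $T\subseteq Q\times\mathbb{Z}^d\times Q$ is a finite set of transitions such that every state has at least one outgoing transition. A configuration is a pair $p\mathbf{v}$ with $p\in Q$, $\mathbf{v}\in\mathbb{N}^d$; its size is $\max_{1\le i\le d}\mathbf{v}(i)$. A computation initiated in $p_0\mathbf{v}_0$ is a finite sequence of configurations $p_0\mathbf{v}_0,\dots,p_n\mathbf{v}_n$ (all with vectors in $\mathbb{N}^d$) such that for each $i<n$ there is a transition $(p_i,\mathbf{u}_{i+1},p_{i+1})\in T$ with $\mathbf{v}_{i+1}=\mathbf{v}_i+\mathbf{u}_{i+1}$; its length is $n$. $L(p\mathbf{v})\in\mathbb{N}\cup\{\infty\}$ is the least bound on the lengths of all computations initiated in $p\mathbf{v}$, and the termination complexity is $\mathcal{L}(n)=\sup\{L(p\mathbf{v}) : p\mathbf{v}\text{ a configuration of size } n\}$. $\mathcal{A}$ is terminating if $\mathcal{L}(n)<\infty$ for all $n$. A finite path is a sequence $p_0,\mathbf{u}_1,p_1,\dots,\mathbf{u}_n,p_n$ with $n\ge1$ and $(p_i,\mathbf{u}_{i+1},p_{i+1})\in T$; $\mathcal{A}$ is strongly connected if there is a finite path from every state to every state.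 A linear map for $\mathcal{A}$ is a function $f(p\mathbf{v})=\mathbf{c}_f^\top\mathbf{v}+\mathbf{w}_f(p)$ with $\mathbf{c}_f\in\mathbb{Q}^d$ (the normal) and $\mathbf{w}_f\in\mathbb{Q}^Q$. A transition $(p,\mathbf{u},q)$ is $f$-ranked if $\mathbf{c}_f^\top\mathbf{u}+\mathbf{w}_f(q)\le\mathbf{w}_f(p)-1$. A ranking function is a linear map $f$ with $\mathbf{c}_f\ge\vec 0$ such that every transition of $\mathcal{A}$ is $f$-ranked. -}

module Defs where

open import Data.Nat as ℕ using (ℕ; zero; suc; _⊔_; _≤_; _*_)
open import Data.Integer as ℤ using (ℤ; +_)
open import Data.Rational as ℚ using (ℚ; 0ℚ; 1ℚ)
open import Data.Fin using (Fin)
open import Data.Vec using (Vec; []; _∷_; foldr; zipWith; map)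
open import Data.Vec.Relation.Unary.All using (All)
open import Data.List using (List)
open import Data.List.Membership.Propositional using (_∈_)
open import Data.Product using (Σ; ∃; ∃-syntax; _×_; _,_)
open import Relation.Binary.PropositionalEquality using (_≡_)

Transition : ℕ → ℕ → Set
Transition k d = Fin k × Vec ℤ d × Fin k

record VASS (d : ℕ) : Set where
  field
    nStates     : ℕ
    nonempty    : 1 ≤ nStates
    trans       : List (Transition nStates d)
    hasOutgoing : (p : Fin nStates) →
                  ∃[ u ] ∃[ q ] ((p , u , q) ∈ trans)
open VASS public

State : ∀ {d} → VASS d → Set
State A = Fin (nStates A)

Config : ∀ {d} → VASS d → Set
Config {d} A = State A × Vec ℕ d

size : ∀ {d} {A : VASS d} → Config A → ℕ
size (_ , v) = foldr _ _⊔_ 0 v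

toℤVec : ∀ {d} → Vec ℕ d → Vec ℤ d
toℤVec = map +_

Step : ∀ {d} (A : VASS d) → Config A → Config A → Set
Step A (p , v) (q , v') =
  Σ _ λ u → ((p , u , q) ∈ trans A) × (toℤVec v' ≡ zipWith ℤ._+_ (toℤVec v) u)

data Computation {d} (A : VASS d) : Config A → ℕ → Set where
  done : ∀ c → Computation A c zero
  step : ∀ {c c' n} → Step A c c' → Computation A c' n → Computation A c (suc n)

LBoundedBy : ∀ {d} (A : VASS d) → Config A → ℕ → Set
LBoundedBy A c B = ∀ n → Computation A c n → n ≤ B

-- 𝓛(n) ≤ B : sup over configurations of size n.
TermComplexityBoundedBy : ∀ {d} (A : VASS d) → ℕ → ℕ → Set
TermComplexityBoundedBy A n B = ∀ (c : Config A) → size {A = A} c ≡ n → LBoundedBy A c B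

Terminating : ∀ {d} → VASS d → Set
Terminating A = ∀ n → ∃[ B ] TermComplexityBoundedBy A n B

LinearComplexity : ∀ {d} → VASS d → Set
LinearComplexity A =
  ∃[ C ] ∃[ n₀ ] (∀ n → n₀ ≤ n → TermComplexityBoundedBy A n (C * n))

data Path {d} (A : VASS d) : State A → State A → Set where
  edge : ∀ {p u q} → (p , u , q) ∈ trans A → Path A p q
  cons : ∀ {p u q r} → (p , u , q) ∈ trans A → Path A q r → Path A p r

StronglyConnected : ∀ {d} → VASS d → Set
StronglyConnected A = ∀ p q → Path A p q

-- Linear maps f(p v) = c_fᵀ v + w_f(p).
dotℤ : ∀ {d} → Vec ℚ d → Vec ℤ d → ℚ
dotℤ c u = foldr _ ℚ._+_ 0ℚ (zipWith (λ a b → a ℚ.* (b ℚ./ 1)) c u)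

record LinearMap {d} (A : VASS d) : Set where
  field
    normal : Vec ℚ d
    weight : State A → ℚ
open LinearMap public

Ranked : ∀ {d} {A : VASS d} → LinearMap A → Transition (nStates A) d → Set
Ranked f (p , u , q) =
  dotℤ (normal f) u ℚ.+ weight f q ℚ.≤ weight f p ℚ.- 1ℚ

IsRankingFunction : ∀ {d} (A : VASS d) → LinearMap A → Set
IsRankingFunction A f =
  All (0ℚ ℚ.≤_) (normal f) × (∀ t → t ∈ trans A → Ranked {A = A} f t)

HasRankingFunction : ∀ {d} → VASS d → Set
HasRankingFunction A = Σ (LinearMap A) (IsRankingFunction A)

{-# OPTIONS --safe #-}

-- A ranking function bounds the length of a computation by its initial value, which is affine in
-- the size of the initial configuration. Conversely, eliminate the weights from the system of
-- ranking inequalities, one state at a time: each elimination composes the paths into a state with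
-- the paths out of it, so that only inequalities  c · effect γ + len γ ≤ 0  for finitely many
-- closed paths γ remain. By Fourier–Motzkin elimination of c, either they have a solution c ≥ 0, or
-- some positive combination of the effects of the γ is nonnegative. In the latter case, a closed
-- path through a fixed state that runs each γ a multiple of k times has length at least k, uses
-- O(k) of each counter, and loses O(1) on the connecting paths; iterating it k times from a
-- configuration of size O(k) gives a computation of length at least k².

module Submission where

open import Defs
open import Data.Nat using (ℕ)
open import Data.Product using (_×_)
open import Function.Bundles using (_⇔_)
open import Data.Nat as ℕ using (zero; suc; _⊔_)
import Data.Nat.Properties as ℕ
import Data.Nat.Tactic.RingSolver as ℕ-Solver
open import Data.Integer as ℤ using (ℤ; +_; -[1+_]; 0ℤ; 1ℤ; ∣_∣; _≤_; _+_; _*_; -_; _-_; +≤+; -≤+)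
open import Data.Integer.Properties as ℤ hiding (_≟_)
open import Data.Integer.Tactic.RingSolver using (solve-∀)
open import Data.Rational as ℚ using (ℚ; 0ℚ; 1ℚ; _/_; ↥_; toℚᵘ)
import Data.Rational.Properties as ℚ
open import Data.Rational.Solver using (module +-*-Solver)
import Data.Rational.Unnormalised as ℚᵘ
import Data.Rational.Unnormalised.Properties as ℚᵘ
open import Data.Fin using (Fin; zero; suc; _≟_; fromℕ<)
open import Data.Vec as Vec using (Vec; []; _∷_; lookup; zipWith; replicate; foldr)
open import Data.Vec.Properties using (lookup-replicate)
open import Data.Vec.Relation.Unary.All as VecAll using ([]; _∷_)
open import Data.List as List using (List; []; _∷_; _++_; cartesianProductWith; concat; tabulate)
open import Data.List.Extrema ≤-totalOrder using (max; min; max≤v⁺; xs≤max; min≤xs)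
open import Data.List.Membership.Propositional using (_∈_)
open import Data.List.Membership.Propositional.Properties using (∈-cartesianProductWith⁺)
open import Data.List.Relation.Unary.All as All using (All; []; _∷_)
import Data.List.Relation.Unary.All.Properties as All
open import Data.List.Relation.Unary.Any using (here; there)
open import Data.Product using (Σ; ∃₂; ∃-syntax; _,_; proj₁; proj₂)
open import Data.Sum using (_⊎_; inj₁; inj₂)
open import Function using (_∘_)
open import Function.Bundles using (mk⇔)
open import Relation.Nullary using (¬_; yes; no; contradiction)
open import Relation.Binary.PropositionalEquality using (_≡_; refl; sym; cong; cong₂; subst; module ≡-Reasoning) renaming (trans to ≡-trans)

-- Theorem of the alternative

dot : ∀ {d} → Vec ℕ d → (Fin d → ℤ) → ℤ
dot []      a = 0ℤ
dot (c ∷ cs) a = + c * a zero + dot cs (a ∘ suc)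

dot-cong : ∀ {d} (c : Vec ℕ d) {a b} → (∀ i → a i ≡ b i) → dot c a ≡ dot c b
dot-cong []       a≗b = refl
dot-cong (c ∷ cs) a≗b = cong₂ (λ x y → + c * x + y) (a≗b zero) (dot-cong cs (a≗b ∘ suc))

dot-linear : ∀ {d} (c : Vec ℕ d) m n a b →
  dot c (λ i → m * a i + n * b i) ≡ m * dot c a + n * dot c b
dot-linear []       m n a b = sym (cong₂ _+_ (*-zeroʳ m) (*-zeroʳ n))
dot-linear (c ∷ cs) m n a b = begin
  + c * (m * a zero + n * b zero) + dot cs (λ i → m * a (suc i) + n * b (suc i))
    ≡⟨ cong (_+_ (+ c * (m * a zero + n * b zero))) (dot-linear cs m n (a ∘ suc) (b ∘ suc)) ⟩
  + c * (m * a zero + n * b zero) + (m * dot cs (a ∘ suc) + n * dot cs (b ∘ suc))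
    ≡⟨ rearrange (+ c) m n (a zero) (b zero) (dot cs (a ∘ suc)) (dot cs (b ∘ suc)) ⟩
  m * dot (c ∷ cs) a + n * dot (c ∷ cs) b ∎
  where
  open ≡-Reasoning
  rearrange : ∀ c m n x y s t →
    c * (m * x + n * y) + (m * s + n * t) ≡ m * (c * x + s) + n * (c * y + t)
  rearrange = solve-∀

dot-scale : ∀ {d} k (c : Vec ℕ d) a → dot (Vec.map (k ℕ.*_) c) a ≡ + k * dot c a
dot-scale k []       a = sym (*-zeroʳ (+ k))
dot-scale k (c ∷ cs) a = begin
  + (k ℕ.* c) * a zero + dot (Vec.map (k ℕ.*_) cs) (a ∘ suc)
    ≡⟨ cong₂ (λ x y → x * a zero + y) (pos-* k c) (dot-scale k cs (a ∘ suc)) ⟩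
  + k * + c * a zero + + k * dot cs (a ∘ suc)
    ≡⟨ factor (+ k) (+ c) (a zero) (dot cs (a ∘ suc)) ⟩
  + k * dot (c ∷ cs) a ∎
  where
  open ≡-Reasoning
  factor : ∀ k c x y → k * c * x + k * y ≡ k * (c * x + y)
  factor = solve-∀

-- An abstract family of inequalities  coeff x · c + const x ≤ 0  in the unknown c, closed under
-- the integer combinations with a positive first and a nonnegative second multiplier.
record Cone (d : ℕ) : Set₁ where
  field
    Row           : Set
    coeff         : Row → Fin d → ℤ
    const         : Row → ℕ
    combine       : ℕ → ℕ → Row → Row → Row
    coeff-combine : ∀ m n x y i → coeff (combine m n x y) i ≡ + suc m * coeff x i + + n * coeff y i
    const-combine : ∀ m n x y → const (combine m n x y) ≡ suc m ℕ.* const x ℕ.+ n ℕ.* const y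

  value : Vec ℕ d → Row → ℤ
  value c x = dot c (coeff x) + + const x

  value-combine : ∀ c m n x y → value c (combine m n x y) ≡ + suc m * value c x + + n * value c y
  value-combine c m n x y = begin
    dot c (coeff (combine m n x y)) + + const (combine m n x y)
      ≡⟨ cong₂ _+_ (dot-cong c (coeff-combine m n x y)) (cong +_ (const-combine m n x y)) ⟩
    dot c (λ i → + suc m * coeff x i + + n * coeff y i) + + (suc m ℕ.* const x ℕ.+ n ℕ.* const y)
      ≡⟨ cong₂ _+_ (dot-linear c (+ suc m) (+ n) (coeff x) (coeff y)) (pos-+ (suc m ℕ.* const x) _) ⟩
    + suc m * dot c (coeff x) + + n * dot c (coeff y) + (+ (suc m ℕ.* const x) + + (n ℕ.* const y))
      ≡⟨ cong (_+_ (+ suc m * dot c (coeff x) + + n * dot c (coeff y)))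
              (cong₂ _+_ (pos-* (suc m) (const x)) (pos-* n (const y))) ⟩
    + suc m * dot c (coeff x) + + n * dot c (coeff y) + (+ suc m * + const x + + n * + const y)
      ≡⟨ regroup (+ suc m) (+ n) (dot c (coeff x)) (dot c (coeff y)) (+ const x) (+ const y) ⟩
    + suc m * value c x + + n * value c y ∎
    where
    open ≡-Reasoning
    regroup : ∀ m n s t a b → m * s + n * t + (m * a + n * b) ≡ m * (s + a) + n * (t + b)
    regroup = solve-∀

-- The third component rebuilds a proof over `xs` from proofs over the two parts, for every `R`: the
-- predicate of interest depends on a solution that is found only after the split.
split : {X : Set} {P N : X → Set} → (∀ x → P x ⊎ N x) → (xs : List X) →
  Σ (List (Σ X P)) λ ps → Σ (List (Σ X N)) λ ns →
    ∀ {R : X → Set} → All (R ∘ proj₁) ps → All (R ∘ proj₁) ns → All R xs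
split P⊎N []       = [] , [] , λ _ _ → []
split P⊎N (x ∷ xs) with P⊎N x | split P⊎N xs
... | inj₁ p | ps , ns , merge = (x , p) ∷ ps , ns , λ { (r ∷ rs) ss → r ∷ merge rs ss }
... | inj₂ n | ps , ns , merge = ps , (x , n) ∷ ns , λ { rs (s ∷ ss) → s ∷ merge rs ss }

-- The maximum x / (1+s) of 0 and the fractions num y / (1+den y).
greatest-fraction : {Y : Set} (num : Y → ℤ) (den : Y → ℕ) (ys : List Y) →
  ∃₂ λ x s → All (λ y → num y * + suc s ≤ + suc (den y) * + x) ys ×
    (x ≡ 0 ⊎ ∃[ y ] (y ∈ ys × + x ≡ num y × s ≡ den y))
greatest-fraction num den [] = 0 , 0 , [] , inj₁ refl
greatest-fraction num den (y ∷ ys) with greatest-fraction num den ys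
... | x , s , bounds , attained with num y * + suc s ≤? + suc (den y) * + x
...   | yes y≤ = x , s , y≤ ∷ bounds , weaken attained
  where
  weaken : (x ≡ 0 ⊎ ∃[ z ] (z ∈ ys × + x ≡ num z × s ≡ den z)) →
           (x ≡ 0 ⊎ ∃[ z ] (z ∈ (y ∷ ys) × + x ≡ num z × s ≡ den z))
  weaken (inj₁ e)            = inj₁ e
  weaken (inj₂ (z , z∈ , e)) = inj₂ (z , there z∈ , e)
...   | no y≰ with num y in eq
-- A fraction exceeding the current maximum, which is at least 0, cannot have a negative numerator.
...     | -[1+ k ] = contradiction (≤-trans -≤+ (≤-reflexive (pos-* (suc (den y)) x))) y≰
...     | + v = v , den y , subst (λ z → z * + suc (den y) ≤ + suc (den y) * + v) (sym eq)
                              (≤-reflexive (*-comm (+ v) (+ suc (den y))))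
                          ∷ All.map below bounds
                , inj₂ (y , here refl , sym eq , refl)
  where
  below : ∀ {z} → num z * + suc s ≤ + suc (den z) * + x → num z * + suc (den y) ≤ + suc (den z) * + v
  below {z} z≤ = *-cancelʳ-≤-pos _ _ (+ suc s) (begin
    num z * + suc (den y) * + suc s     ≡⟨ swap (num z) (+ suc (den y)) (+ suc s) ⟩
    num z * + suc s * + suc (den y)     ≤⟨ *-monoʳ-≤-nonNeg (+ suc (den y)) z≤ ⟩
    + suc (den z) * + x * + suc (den y) ≡⟨ assoc′ (+ suc (den z)) (+ x) (+ suc (den y)) ⟩
    + suc (den z) * (+ suc (den y) * + x) ≤⟨ *-monoˡ-≤-nonNeg (+ suc (den z)) (<⇒≤ (≰⇒> y≰)) ⟩
    + suc (den z) * (+ v * + suc s)     ≡⟨ sym (*-assoc (+ suc (den z)) (+ v) (+ suc s)) ⟩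
    + suc (den z) * + v * + suc s       ∎)
    where
    open ≤-Reasoning
    swap : ∀ a b c → a * b * c ≡ a * c * b
    swap = solve-∀
    assoc′ : ∀ a b c → a * b * c ≡ a * (c * b)
    assoc′ = solve-∀

nonneg⊎neg : ∀ i → (0ℤ ≤ i) ⊎ (∃[ k ] i ≡ -[1+ k ])
nonneg⊎neg (+ n)    = inj₁ (+≤+ ℕ.z≤n)
nonneg⊎neg -[1+ k ] = inj₂ (k , refl)

module Elimination {d} (K : Cone (suc d)) where
  open Cone K

  head : Row → ℤ
  head x = coeff x zero

  NonNegRow NegRow : Set
  NonNegRow = Σ Row λ x → 0ℤ ≤ head x
  NegRow    = Σ Row λ x → ∃[ k ] head x ≡ -[1+ k ]

  -- Restricting to the rows with nonnegative head keeps the cone closed under combine, and hence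
  -- a certificate for the tail is a certificate outright.
  tailCone : Cone d
  tailCone = record
    { Row           = NonNegRow
    ; coeff         = λ (x , _) i → coeff x (suc i)
    ; const         = λ (x , _) → const x
    ; combine       = λ m n (x , 0≤x) (y , 0≤y) → combine m n x y ,
        subst (0ℤ ≤_) (sym (coeff-combine m n x y zero))
          (+-mono-≤ (scale (suc m) 0≤x) (scale n 0≤y))
    ; coeff-combine = λ m n (x , _) (y , _) i → coeff-combine m n x y (suc i)
    ; const-combine = λ m n (x , _) (y , _) → const-combine m n x y
    }
    where
    scale : ∀ k {i} → 0ℤ ≤ i → 0ℤ ≤ + k * i
    scale k {i} 0≤i = subst (_≤ + k * i) (*-zeroʳ (+ k)) (*-monoˡ-≤-nonNeg (+ k) 0≤i)

  module T = Cone tailCone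

  -- The multipliers are the absolute values of the two heads, crosswise, so the head of the
  -- combination is 0. The row with negative head supplies the positive multiplier `suc k` that
  -- `combine` asks for; the other head may be 0.
  cancelHead : NonNegRow → NegRow → NonNegRow
  cancelHead (x , 0≤x) (y , k , eq) = combine k ∣ head x ∣ x y , ≤-reflexive (sym (begin
    head (combine k ∣ head x ∣ x y)            ≡⟨ coeff-combine k ∣ head x ∣ x y zero ⟩
    + suc k * head x + + ∣ head x ∣ * head y   ≡⟨ cong₂ (λ a b → + suc k * head x + a * b) (0≤i⇒+∣i∣≡i 0≤x) eq ⟩
    + suc k * head x + head x * - (+ suc k)    ≡⟨ cancel (+ suc k) (head x) ⟩
    0ℤ                                         ∎))
    where
    open ≡-Reasoning
    cancel : ∀ m h → m * h + h * (- m) ≡ 0ℤ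
    cancel = solve-∀

  -- Defined on all rows, since those with negative head lie outside `tailCone` but yield lower
  -- bounds through it. On the rows of `tailCone` it unfolds to `T.value`.
  residual : Vec ℕ d → Row → ℤ
  residual c x = dot c (coeff x ∘ suc) + + const x

  residual-combine : ∀ c m n x y →
    residual c (combine m n x y) ≡ + suc m * residual c x + + n * residual c y
  residual-combine c m n x y = begin
    residual c (combine m n x y)                        ≡⟨ value-0∷ (combine m n x y) ⟨
    value (0 ∷ c) (combine m n x y)                     ≡⟨ value-combine (0 ∷ c) m n x y ⟩
    + suc m * value (0 ∷ c) x + + n * value (0 ∷ c) y   ≡⟨ cong₂ (λ s t → + suc m * s + + n * t) (value-0∷ x) (value-0∷ y) ⟩
    + suc m * residual c x + + n * residual c y         ∎
    where
    open ≡-Reasoning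
    value-0∷ : ∀ z → value (0 ∷ c) z ≡ residual c z
    value-0∷ z = cong (_+ + const z) (+-identityˡ (dot c (coeff z ∘ suc)))

  -- Multiplying `c` by `suc s` clears the denominator of the new coordinate `x / (1 + s)`. The
  -- constant is not scaled along; being natural, it is at most its multiple, which gives an
  -- inequality in the useful direction.
  value-extend : ∀ c x s z →
    value (x ∷ Vec.map (suc s ℕ.*_) c) z ≤ + x * head z + + suc s * residual c z
  value-extend c x s z = begin
    + x * head z + dot (Vec.map (suc s ℕ.*_) c) (coeff z ∘ suc) + + const z
      ≡⟨ cong (λ t → + x * head z + t + + const z) (dot-scale (suc s) c (coeff z ∘ suc)) ⟩
    + x * head z + + suc s * dot c (coeff z ∘ suc) + + const z
      ≤⟨ +-monoʳ-≤ (+ x * head z + + suc s * dot c (coeff z ∘ suc)) const≤ ⟩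
    + x * head z + + suc s * dot c (coeff z ∘ suc) + + suc s * + const z
      ≡⟨ regroup (+ x * head z) (+ suc s) (dot c (coeff z ∘ suc)) (+ const z) ⟩
    + x * head z + + suc s * residual c z ∎
    where
    open ≤-Reasoning
    const≤ : + const z ≤ + suc s * + const z
    const≤ = ≤-trans (+≤+ (ℕ.m≤n*m (const z) (suc s))) (≤-reflexive (pos-* (suc s) (const z)))
    regroup : ∀ h s t b → h + s * t + s * b ≡ h + s * (t + b)
    regroup = solve-∀

  -- The new coordinate has the lower bounds 0 and `residual / (1 + k)`, one for each row of `ns`.
  -- The rows of `ps` favour small values, so the greatest lower bound is chosen. Combined with the
  -- bound 0, a row of `ps` merely drops its head, which is why `ps` itself stands next to the rows
  -- of `cancelHead`.
  back-substitute : ∀ (ps : List NonNegRow) (ns : List NegRow) c →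
    All (λ p → T.value c p ≤ 0ℤ) (ps ++ cartesianProductWith cancelHead ps ns) →
    ∃[ c′ ] (All (λ p → value c′ (proj₁ p) ≤ 0ℤ) ps × All (λ n → value c′ (proj₁ n) ≤ 0ℤ) ns)
  back-substitute ps ns c sat
    with greatest-fraction (residual c ∘ proj₁) (proj₁ ∘ proj₂) ns
  ... | x , s , bounds , attained =
    x ∷ Vec.map (suc s ℕ.*_) c , All.tabulate (λ {p} p∈ps → pos p p∈ps attained) , All.map (λ {n} → neg n) bounds
    where
    open ≤-Reasoning
    neg : ∀ n → residual c (proj₁ n) * + suc s ≤ + suc (proj₁ (proj₂ n)) * + x →
          value (x ∷ Vec.map (suc s ℕ.*_) c) (proj₁ n) ≤ 0ℤ
    neg (z , k , eq) bound = begin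
      value (x ∷ Vec.map (suc s ℕ.*_) c) z       ≤⟨ value-extend c x s z ⟩
      + x * head z + + suc s * residual c z      ≡⟨ cong₂ (λ h r → + x * h + r) eq (*-comm (+ suc s) (residual c z)) ⟩
      + x * - (+ suc k) + residual c z * + suc s ≤⟨ +-monoʳ-≤ (+ x * - (+ suc k)) bound ⟩
      + x * - (+ suc k) + + suc k * + x          ≡⟨ cancel (+ x) (+ suc k) ⟩
      0ℤ                                         ∎
      where
      cancel : ∀ x k → x * (- k) + k * x ≡ 0ℤ
      cancel = solve-∀

    pos : ∀ p → p ∈ ps → (x ≡ 0 ⊎ ∃[ n ] (n ∈ ns × + x ≡ residual c (proj₁ n) × s ≡ proj₁ (proj₂ n))) →
          value (x ∷ Vec.map (suc s ℕ.*_) c) (proj₁ p) ≤ 0ℤ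
    pos (z , 0≤z) z∈ps (inj₁ refl) = begin
      value (0 ∷ Vec.map (suc s ℕ.*_) c) z ≤⟨ value-extend c 0 s z ⟩
      0ℤ + + suc s * residual c z          ≡⟨ +-identityˡ (+ suc s * residual c z) ⟩
      + suc s * residual c z               ≤⟨ *-monoˡ-≤-nonNeg (+ suc s) (All.lookup (All.++⁻ˡ ps sat) z∈ps) ⟩
      + suc s * 0ℤ                         ≡⟨ *-zeroʳ (+ suc s) ⟩
      0ℤ                                   ∎
    -- The lower bound from `y` is attained, so the value at `z` is at most the residual of
    -- `cancelHead` applied to `z` and `y`, a row of the eliminated system.
    pos (z , 0≤z) z∈ps (inj₂ (n@(y , k , eq) , n∈ns , x≡ , refl)) = begin
      value (x ∷ Vec.map (suc s ℕ.*_) c) z              ≤⟨ value-extend c x s z ⟩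
      + x * head z + + suc s * residual c z             ≡⟨ cong₂ (λ a h → a * h + + suc s * residual c z) x≡ (sym (0≤i⇒+∣i∣≡i 0≤z)) ⟩
      residual c y * + ∣ head z ∣ + + suc s * residual c z ≡⟨ swap (residual c y) (+ ∣ head z ∣) (+ suc s * residual c z) ⟩
      + suc s * residual c z + + ∣ head z ∣ * residual c y ≡⟨ residual-combine c s ∣ head z ∣ z y ⟨
      residual c (combine s ∣ head z ∣ z y)             ≤⟨ All.lookup (All.++⁻ʳ ps sat) (∈-cartesianProductWith⁺ cancelHead z∈ps n∈ns) ⟩
      0ℤ                                                ∎
      where
      swap : ∀ a b c → a * b + c ≡ c + b * a
      swap = solve-∀

-- Induction on the dimension. The row of the second alternative is not tied to `xs`: whatever a
-- certificate has to satisfy is built into the type `Row`, as realisability is in `pathCone`.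
farkas : ∀ {d} (K : Cone d) → let open Cone K in (xs : List Row) →
  (∃[ c ] All (λ x → value c x ≤ 0ℤ) xs) ⊎ (∃[ x ] (∀ i → 0ℤ ≤ coeff x i))
farkas {zero}  K []       = inj₁ ([] , [])
-- Without coordinates, any row is a certificate, whatever its constant.
farkas {zero}  K (x ∷ xs) = inj₂ (x , λ ())
farkas {suc d} K xs with split (nonneg⊎neg ∘ Elimination.head K) xs
... | ps , ns , merge with farkas (Elimination.tailCone K) (ps ++ cartesianProductWith (Elimination.cancelHead K) ps ns)
...   | inj₂ ((x , 0≤x) , 0≤tail) = inj₂ (x , λ { zero → 0≤x ; (suc i) → 0≤tail i })
...   | inj₁ (c , sat) with Elimination.back-substitute K ps ns c sat
...     | c′ , satₚ , satₙ = inj₁ (c′ , merge satₚ satₙ)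

-- Potentials

between : ∀ (ls us : List ℤ) → All (λ l → All (l ≤_) us) ls →
  ∃[ x ] (All (_≤ x) ls × All (x ≤_) us)
between ls us ls≤us = max b ls , xs≤max b ls , All.tabulate λ u∈us →
  max≤v⁺ (All.lookup (min≤xs 0ℤ us) u∈us) (All.map (λ l≤us → All.lookup l≤us u∈us) ls≤us)
  -- The start value of the maximum, needed when `ls` is empty; lying below all of `us`, it violates
  -- no upper bound.
  where b = min 0ℤ us

gather : ∀ {k} {B : Fin k → Set} → (∀ i → B i → ℤ) → (∀ i → List (B i)) → List ℤ
gather f xs = concat (tabulate λ i → List.map (f i) (xs i))

gather⁺ : ∀ {k} {B : Fin k → Set} {f : ∀ i → B i → ℤ} {xs : ∀ i → List (B i)} {P : ℤ → Set} →
  (∀ i → All (P ∘ f i) (xs i)) → All P (gather f xs)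
gather⁺ Pf = All.concat⁺ (All.tabulate⁺ λ i → All.map⁺ (Pf i))

gather⁻ : ∀ {k} {B : Fin k → Set} {f : ∀ i → B i → ℤ} {xs : ∀ i → List (B i)} {P : ℤ → Set} →
  All P (gather f xs) → ∀ i → All (P ∘ f i) (xs i)
gather⁻ {xs = xs} Ps i = All.map⁻ (All.tabulate⁻ (All.concat⁻ Ps) i)

-- Eliminating the weight of state zero from the system  w q + φ e ≤ w p  (one inequality per edge e
-- from p to q) composes every edge into it with every edge out of it; what remains of its loops
-- no longer involves the weights.
bypass : ∀ {k} {E : Fin (suc k) → Fin (suc k) → Set} → (∀ {p q r} → E p q → E q r → E p r) →
  (∀ p q → List (E p q)) → ∀ p q → List (E (suc p) (suc q))
bypass _∙_ es p q = es (suc p) (suc q) ++ cartesianProductWith _∙_ (es (suc p) zero) (es zero (suc q))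

-- The loops at `p` present when `p` is eliminated: composites of edges whose inner states were
-- eliminated before. Loops are never iterated, because a loop only contributes the condition
-- `φ e ≤ 0`, so the lists stay finite.
cycles : ∀ {k} {E : Fin k → Fin k → Set} → (∀ {p q r} → E p q → E q r → E p r) →
  (∀ p q → List (E p q)) → ∀ p → List (E p p)
cycles _∙_ es zero    = es zero zero
cycles _∙_ es (suc p) = cycles _∙_ (bypass _∙_ es) p

-- Given weights of the other states, edges out of state zero bound its weight from below and edges
-- into it from above. The inequality of a bypass says that the lower bound of its second half is at
-- most the upper bound of its first half, so `between` finds a value.
potential : ∀ {k} {E : Fin k → Fin k → Set} (_∙_ : ∀ {p q r} → E p q → E q r → E p r)
  (es : ∀ p q → List (E p q)) (φ : ∀ {p q} → E p q → ℤ) →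
  (∀ {p q r} (x : E p q) (y : E q r) → φ (x ∙ y) ≡ φ x + φ y) →
  (∀ p → All (λ e → φ e ≤ 0ℤ) (cycles _∙_ es p)) →
  Σ (Fin k → ℤ) λ w → ∀ p q → All (λ e → w q + φ e ≤ w p) (es p q)
potential {zero}  _∙_ es φ φ-∙ sat = (λ ()) , λ ()
potential {suc k} {E} _∙_ es φ φ-∙ sat
  with potential _∙_ (bypass _∙_ es) φ φ-∙ (sat ∘ suc)
... | w , w-sat
  with between (gather (λ q e → w q + φ e) (λ q → es zero (suc q)))
               (gather (λ p e → w p - φ e) (λ p → es (suc p) zero))
               (gather⁺ λ q → All.tabulate λ {y} y∈ → gather⁺ λ p → All.tabulate λ {x} x∈ →
                 through p q x y (All.lookup (All.++⁻ʳ (es (suc p) (suc q)) (w-sat p q)) (∈-cartesianProductWith⁺ _∙_ x∈ y∈)))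
  where
  open ≤-Reasoning
  through : ∀ p q (x : E (suc p) zero) (y : E zero (suc q)) → w q + φ (x ∙ y) ≤ w p → w q + φ y ≤ w p - φ x
  through p q x y le = begin
    w q + φ y               ≡⟨ shift (w q) (φ x) (φ y) ⟩
    w q + (φ x + φ y) - φ x ≡⟨ cong (λ t → w q + t - φ x) (φ-∙ x y) ⟨
    w q + φ (x ∙ y) - φ x   ≤⟨ +-monoˡ-≤ (- φ x) le ⟩
    w p - φ x               ∎
    where
    shift : ∀ a b c → a + c ≡ a + (b + c) - b
    shift = solve-∀
... | w₀ , lower , upper = w′ , sat′
  where
  open ≤-Reasoning
  w′ : Fin (suc k) → ℤ
  w′ zero    = w₀
  w′ (suc p) = w p

  sat′ : ∀ p q → All (λ e → w′ q + φ e ≤ w′ p) (es p q)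
  sat′ zero zero = All.map (λ {e} le → begin
    w₀ + φ e ≤⟨ +-monoʳ-≤ w₀ le ⟩
    w₀ + 0ℤ  ≡⟨ +-identityʳ w₀ ⟩
    w₀       ∎) (sat zero)
  sat′ zero    (suc q) = gather⁻ lower q
  sat′ (suc p) zero    = All.map (λ {e} le → begin
    w₀ + φ e        ≤⟨ +-monoˡ-≤ (φ e) le ⟩
    w p - φ e + φ e ≡⟨ undo (w p) (φ e) ⟩
    w p             ∎) (gather⁻ upper p)
    where
    undo : ∀ a b → a - b + b ≡ a
    undo = solve-∀
  sat′ (suc p) (suc q) = All.++⁻ˡ (es (suc p) (suc q)) (w-sat p q)

-- Long computations from realisable effects

∣i∣≤n⇒0≤n+i : ∀ {n} i → ∣ i ∣ ℕ.≤ n → 0ℤ ≤ + n + i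
∣i∣≤n⇒0≤n+i     (+ m)    _   = +≤+ ℕ.z≤n
∣i∣≤n⇒0≤n+i {n} -[1+ m ] m<n = subst (0ℤ ≤_) (sym (⊖-≥ m<n)) (+≤+ ℕ.z≤n)

norm : ∀ {d} → Vec ℤ d → ℕ
norm u = Vec.sum (Vec.map ∣_∣ u)

∣lookup∣≤norm : ∀ {d} (u : Vec ℤ d) i → ∣ lookup u i ∣ ℕ.≤ norm u
∣lookup∣≤norm (x ∷ u) zero    = ℕ.m≤m+n ∣ x ∣ (norm u)
∣lookup∣≤norm (x ∷ u) (suc i) = ℕ.≤-trans (∣lookup∣≤norm u i) (ℕ.m≤n+m (norm u) ∣ x ∣)

fire : ∀ {d} (v : Vec ℕ d) (u : Vec ℤ d) → (∀ i → ∣ lookup u i ∣ ℕ.≤ lookup v i) →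
  ∃[ v′ ] (toℤVec v′ ≡ zipWith _+_ (toℤVec v) u × (∀ i → + lookup v′ i ≡ + lookup v i + lookup u i))
fire []      []      _   = [] , refl , λ ()
fire (n ∷ v) (x ∷ u) u≤v with fire v u (u≤v ∘ suc)
... | v′ , eq , eqs = ∣ + n + x ∣ ∷ v′ , cong₂ _∷_ eq₀ eq , λ { zero → eq₀ ; (suc i) → eqs i }
  where
  eq₀ : + ∣ + n + x ∣ ≡ + n + x
  eq₀ = 0≤i⇒+∣i∣≡i (∣i∣≤n⇒0≤n+i x (u≤v zero))

size-replicate : ∀ d n → foldr (λ _ → ℕ) _⊔_ 0 (replicate (suc d) n) ≡ n
size-replicate zero    n = ℕ.⊔-identityʳ n
size-replicate (suc d) n = ≡-trans (cong (n ⊔_) (size-replicate d n)) (ℕ.⊔-idem n)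

module Paths {d} (A : VASS d) where

  infixr 5 _⊕_

  _⊕_ : ∀ {p q r} → Path A p q → Path A q r → Path A p r
  edge t   ⊕ σ = cons t σ
  cons t π ⊕ σ = cons t (π ⊕ σ)

  len : ∀ {p q} → Path A p q → ℕ
  len (edge _)   = 1
  len (cons _ π) = suc (len π)

  -- Absolute values are summed without cancellation, so `cost π` in every counter suffices to run
  -- `π`, in whatever order gains and losses occur.
  cost : ∀ {p q} → Path A p q → ℕ
  cost (edge {u = u} _)   = norm u
  cost (cons {u = u} _ π) = norm u ℕ.+ cost π

  effect : ∀ {p q} → Path A p q → Fin d → ℤ
  effect (edge {u = u} _)   i = lookup u i
  effect (cons {u = u} _ π) i = lookup u i + effect π i

  len-⊕ : ∀ {p q r} (π : Path A p q) (σ : Path A q r) → len (π ⊕ σ) ≡ len π ℕ.+ len σ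
  len-⊕ (edge _)   σ = refl
  len-⊕ (cons _ π) σ = cong suc (len-⊕ π σ)

  cost-⊕ : ∀ {p q r} (π : Path A p q) (σ : Path A q r) → cost (π ⊕ σ) ≡ cost π ℕ.+ cost σ
  cost-⊕ (edge _)           σ = refl
  cost-⊕ (cons {u = u} _ π) σ = ≡-trans (cong (norm u ℕ.+_) (cost-⊕ π σ)) (sym (ℕ.+-assoc (norm u) _ _))

  effect-⊕ : ∀ {p q r} (π : Path A p q) (σ : Path A q r) i → effect (π ⊕ σ) i ≡ effect π i + effect σ i
  effect-⊕ (edge _)           σ i = refl
  effect-⊕ (cons {u = u} _ π) σ i =
    ≡-trans (cong (λ z → lookup u i + z) (effect-⊕ π σ i)) (sym (+-assoc (lookup u i) _ _))

  1≤len : ∀ {p q} (π : Path A p q) → 1 ℕ.≤ len π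
  1≤len (edge _)   = ℕ.≤-refl
  1≤len (cons _ π) = ℕ.s≤s ℕ.z≤n

  0≤cost+effect : ∀ {p q} (π : Path A p q) i → 0ℤ ≤ + cost π + effect π i
  0≤cost+effect (edge {u = u} _)   i = ∣i∣≤n⇒0≤n+i (lookup u i) (∣lookup∣≤norm u i)
  0≤cost+effect (cons {u = u} _ π) i = begin
    0ℤ + 0ℤ
      ≤⟨ +-mono-≤ (∣i∣≤n⇒0≤n+i (lookup u i) (∣lookup∣≤norm u i)) (0≤cost+effect π i) ⟩
    (+ norm u + lookup u i) + (+ cost π + effect π i)
      ≡⟨ interchange (+ norm u) (lookup u i) (+ cost π) (effect π i) ⟩
    (+ norm u + + cost π) + (lookup u i + effect π i) ∎
    where
    open ≤-Reasoning
    interchange : ∀ a b c d → (a + b) + (c + d) ≡ (a + c) + (b + d)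
    interchange = solve-∀

  -- A transition lowers a counter by at most its norm, which is also what the cost of the remaining
  -- path loses. The result is a continuation because `Computation` does not record its last
  -- configuration.
  run : ∀ {p q} (π : Path A p q) v → (∀ i → cost π ℕ.≤ lookup v i) →
    ∃[ v′ ] ((∀ i → + lookup v′ i ≡ + lookup v i + effect π i) ×
             (∀ {n} → Computation A (q , v′) n → Computation A (p , v) (len π ℕ.+ n)))
  run (edge {u = u} t) v cost≤v with fire v u (λ i → ℕ.≤-trans (∣lookup∣≤norm u i) (cost≤v i))
  ... | v′ , eq , eqs = v′ , eqs , step (u , t , eq)
  run (cons {u = u} t π) v cost≤v
    with fire v u (λ i → ℕ.≤-trans (∣lookup∣≤norm u i) (ℕ.≤-trans (ℕ.m≤m+n (norm u) (cost π)) (cost≤v i)))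
  ... | v₁ , eq , eqs with run π v₁ cost≤v₁
    where
    open ≤-Reasoning
    rearrange : ∀ n u c → (n + u) + c ≡ (n + c) + u
    rearrange = solve-∀
    cost≤v₁ : ∀ i → cost π ℕ.≤ lookup v₁ i
    cost≤v₁ i = drop‿+≤+ (begin
      + cost π                            ≡⟨ +-identityˡ (+ cost π) ⟨
      0ℤ + + cost π                       ≤⟨ +-monoˡ-≤ (+ cost π) (∣i∣≤n⇒0≤n+i (lookup u i) (∣lookup∣≤norm u i)) ⟩
      (+ norm u + lookup u i) + + cost π  ≡⟨ rearrange (+ norm u) (lookup u i) (+ cost π) ⟩
      + (norm u ℕ.+ cost π) + lookup u i  ≤⟨ +-monoˡ-≤ (lookup u i) (+≤+ (cost≤v i)) ⟩
      + lookup v i + lookup u i           ≡⟨ eqs i ⟨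
      + lookup v₁ i                       ∎)
  ...   | v′ , eqs′ , continue =
    v′
    , (λ i → ≡-trans (eqs′ i) (≡-trans (cong (λ z → z + effect π i) (eqs i)) (+-assoc (+ lookup v i) (lookup u i) _)))
    , λ γ → step (u , t , eq) (continue γ)

  -- Each round is paid for by `D`, its net loss at most; the extra `cost π` covers the dips inside
  -- the round being run.
  rounds : ∀ {p} (π : Path A p p) D → (∀ i → 0ℤ ≤ effect π i + + D) →
    ∀ j v → (∀ i → j ℕ.* D ℕ.+ cost π ℕ.≤ lookup v i) → Computation A (p , v) (j ℕ.* len π)
  rounds π D drop≤D zero    v enough = done _
  rounds π D drop≤D (suc j) v enough with run π v (λ i → ℕ.≤-trans (ℕ.m≤n+m (cost π) _) (enough i))
  ... | v′ , eqs , continue = continue (rounds π D drop≤D j v′ enough′)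
    where
    open ≤-Reasoning
    rearrange : ∀ D a e → (e + D) + a ≡ D + a + e
    rearrange = solve-∀
    enough′ : ∀ i → j ℕ.* D ℕ.+ cost π ℕ.≤ lookup v′ i
    enough′ i = drop‿+≤+ (begin
      + (j ℕ.* D ℕ.+ cost π)                          ≡⟨ +-identityˡ _ ⟨
      0ℤ + + (j ℕ.* D ℕ.+ cost π)                     ≤⟨ +-monoˡ-≤ (+ (j ℕ.* D ℕ.+ cost π)) (drop≤D i) ⟩
      (effect π i + + D) + + (j ℕ.* D ℕ.+ cost π)     ≡⟨ rearrange (+ D) (+ (j ℕ.* D ℕ.+ cost π)) (effect π i) ⟩
      + (D ℕ.+ (j ℕ.* D ℕ.+ cost π)) + effect π i     ≡⟨ cong (λ z → + z + effect π i) (ℕ.+-assoc D (j ℕ.* D) (cost π)) ⟨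
      + (suc j ℕ.* D ℕ.+ cost π) + effect π i         ≤⟨ +-monoˡ-≤ (effect π i) (+≤+ (enough i)) ⟩
      + lookup v i + effect π i                       ≡⟨ eqs i ⟨
      + lookup v′ i                                   ∎)

  -- Up to a loss bounded independently of k, the multiple k e is the effect of a closed path
  -- through p of length at least k and cost linear in k.
  record Realisable (p : State A) (e : Fin d → ℤ) : Set where
    field
      loss rate : ℕ
      path      : ℕ → Path A p p
      k≤len     : ∀ k → k ℕ.≤ len (path k)
      cost≤     : ∀ k → cost (path k) ℕ.≤ k ℕ.* rate ℕ.+ loss
      effect≥   : ∀ k i → + k * e i ≤ effect (path k) i + + loss

  -- Both families are closed at the same state and can be concatenated, after rescaling `k` by the
  -- multipliers. The losses add up once, hence stay independent of `k`. Positivity of `suc m` keeps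
  -- the length at least `k`.
  realisable-combine : ∀ {p e f} m n → Realisable p e → Realisable p f →
    Realisable p (λ i → + suc m * e i + + n * f i)
  realisable-combine {p} {e} {f} m n R S = record
    { loss    = R.loss ℕ.+ S.loss
    ; rate    = suc m ℕ.* R.rate ℕ.+ n ℕ.* S.rate
    ; path    = path′
    ; k≤len   = λ k → let open ℕ.≤-Reasoning in begin
        k                                                        ≤⟨ ℕ.m≤m+n k (m ℕ.* k) ⟩
        suc m ℕ.* k                                              ≤⟨ R.k≤len (suc m ℕ.* k) ⟩
        len (R.path (suc m ℕ.* k))                               ≤⟨ ℕ.m≤m+n _ _ ⟩
        len (R.path (suc m ℕ.* k)) ℕ.+ len (S.path (n ℕ.* k))    ≡⟨ len-⊕ (R.path (suc m ℕ.* k)) _ ⟨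
        len (path′ k)                                            ∎
    ; cost≤   = λ k → let open ℕ.≤-Reasoning in begin
        cost (path′ k)                                           ≡⟨ cost-⊕ (R.path (suc m ℕ.* k)) _ ⟩
        cost (R.path (suc m ℕ.* k)) ℕ.+ cost (S.path (n ℕ.* k))  ≤⟨ ℕ.+-mono-≤ (R.cost≤ (suc m ℕ.* k)) (S.cost≤ (n ℕ.* k)) ⟩
        (suc m ℕ.* k ℕ.* R.rate ℕ.+ R.loss) ℕ.+ (n ℕ.* k ℕ.* S.rate ℕ.+ S.loss)
          ≡⟨ collectℕ (suc m) n k R.rate S.rate R.loss S.loss ⟩
        k ℕ.* (suc m ℕ.* R.rate ℕ.+ n ℕ.* S.rate) ℕ.+ (R.loss ℕ.+ S.loss) ∎
    ; effect≥ = λ k i → let open ≤-Reasoning in begin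
        + k * (+ suc m * e i + + n * f i)
          ≡⟨ expand (+ k) (+ suc m) (+ n) (e i) (f i) ⟩
        (+ suc m * + k) * e i + (+ n * + k) * f i
          ≡⟨ cong₂ (λ a b → a * e i + b * f i) (pos-* (suc m) k) (pos-* n k) ⟨
        + (suc m ℕ.* k) * e i + + (n ℕ.* k) * f i
          ≤⟨ +-mono-≤ (R.effect≥ (suc m ℕ.* k) i) (S.effect≥ (n ℕ.* k) i) ⟩
        (effect (R.path (suc m ℕ.* k)) i + + R.loss) + (effect (S.path (n ℕ.* k)) i + + S.loss)
          ≡⟨ interchange (effect (R.path (suc m ℕ.* k)) i) (+ R.loss) (effect (S.path (n ℕ.* k)) i) (+ S.loss) ⟩
        (effect (R.path (suc m ℕ.* k)) i + effect (S.path (n ℕ.* k)) i) + (+ R.loss + + S.loss)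
          ≡⟨ cong (λ z → z + + (R.loss ℕ.+ S.loss)) (effect-⊕ (R.path (suc m ℕ.* k)) _ i) ⟨
        effect (path′ k) i + + (R.loss ℕ.+ S.loss) ∎
    }
    where
    module R = Realisable R
    module S = Realisable S
    path′ : ℕ → Path A p p
    path′ k = R.path (suc m ℕ.* k) ⊕ S.path (n ℕ.* k)
    collectℕ : ∀ m n k r s a b →
      (m ℕ.* k ℕ.* r ℕ.+ a) ℕ.+ (n ℕ.* k ℕ.* s ℕ.+ b) ≡ k ℕ.* (m ℕ.* r ℕ.+ n ℕ.* s) ℕ.+ (a ℕ.+ b)
    collectℕ = ℕ-Solver.solve-∀
    expand : ∀ k m n x y → k * (m * x + n * y) ≡ (m * k) * x + (n * k) * y
    expand = solve-∀
    interchange : ∀ a b c d → (a + b) + (c + d) ≡ (a + c) + (b + d)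
    interchange = solve-∀

  -- The final `β` makes zero repetitions possible, as a `Path` has at least one transition.
  pump : ∀ {q r} → Path A q q → Path A q r → ℕ → Path A q r
  pump γ β zero    = β
  pump γ β (suc k) = γ ⊕ pump γ β k

  k≤len-pump : ∀ {q r} (γ : Path A q q) (β : Path A q r) k → k ℕ.≤ len (pump γ β k)
  k≤len-pump γ β zero    = ℕ.z≤n
  k≤len-pump γ β (suc k) = subst (suc k ℕ.≤_) (sym (len-⊕ γ (pump γ β k)))
    (ℕ.+-mono-≤ (1≤len γ) (k≤len-pump γ β k))

  cost-pump : ∀ {q r} (γ : Path A q q) (β : Path A q r) k → cost (pump γ β k) ≡ k ℕ.* cost γ ℕ.+ cost β
  cost-pump γ β zero    = refl
  cost-pump γ β (suc k) = ≡-trans (cost-⊕ γ (pump γ β k))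
    (≡-trans (cong (cost γ ℕ.+_) (cost-pump γ β k)) (sym (ℕ.+-assoc (cost γ) _ _)))

  effect-pump : ∀ {q r} (γ : Path A q q) (β : Path A q r) k i →
    effect (pump γ β k) i ≡ + k * effect γ i + effect β i
  effect-pump γ β zero    i = sym (+-identityˡ (effect β i))
  effect-pump γ β (suc k) i = begin
    effect (γ ⊕ pump γ β k) i                          ≡⟨ effect-⊕ γ (pump γ β k) i ⟩
    effect γ i + effect (pump γ β k) i                 ≡⟨ cong (λ z → effect γ i + z) (effect-pump γ β k i) ⟩
    effect γ i + (+ k * effect γ i + effect β i)       ≡⟨ unfold (+ k) (effect γ i) (effect β i) ⟩
    + suc k * effect γ i + effect β i                  ∎
    where
    open ≡-Reasoning
    unfold : ∀ k x y → x + (k * x + y) ≡ (1ℤ + k) * x + y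
    unfold = solve-∀

  -- The connecting paths are run once for each `k`, so what they take from a counter, at most their
  -- cost, goes into `loss`.
  cycle-realisable : ∀ {p q} → Path A p q → (γ : Path A q q) → Path A q p → Realisable p (effect γ)
  cycle-realisable {p} {q} α γ β = record
    { loss    = cost α ℕ.+ cost β
    ; rate    = cost γ
    ; path    = λ k → α ⊕ pump γ β k
    ; k≤len   = λ k → ℕ.≤-trans (k≤len-pump γ β k)
                  (ℕ.≤-trans (ℕ.m≤n+m _ (len α)) (ℕ.≤-reflexive (sym (len-⊕ α (pump γ β k)))))
    ; cost≤   = λ k → ℕ.≤-reflexive (≡-trans (cost-⊕ α (pump γ β k))
                  (≡-trans (cong (cost α ℕ.+_) (cost-pump γ β k)) (rotate (cost α) (k ℕ.* cost γ) (cost β))))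
    ; effect≥ = λ k i → let open ≤-Reasoning in begin
        + k * effect γ i
          ≡⟨ +-identityʳ _ ⟨
        + k * effect γ i + (0ℤ + 0ℤ)
          ≤⟨ +-monoʳ-≤ (+ k * effect γ i) (+-mono-≤ (0≤cost+effect α i) (0≤cost+effect β i)) ⟩
        + k * effect γ i + ((+ cost α + effect α i) + (+ cost β + effect β i))
          ≡⟨ regroup (+ k * effect γ i) (+ cost α) (effect α i) (+ cost β) (effect β i) ⟩
        (effect α i + (+ k * effect γ i + effect β i)) + (+ cost α + + cost β)
          ≡⟨ cong (λ z → (effect α i + z) + + (cost α ℕ.+ cost β)) (effect-pump γ β k i) ⟨
        (effect α i + effect (pump γ β k) i) + + (cost α ℕ.+ cost β)
          ≡⟨ cong (λ z → z + + (cost α ℕ.+ cost β)) (effect-⊕ α (pump γ β k) i) ⟨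
        effect (α ⊕ pump γ β k) i + + (cost α ℕ.+ cost β) ∎
    }
    where
    rotate : ∀ a b c → a ℕ.+ (b ℕ.+ c) ≡ b ℕ.+ (a ℕ.+ c)
    rotate = ℕ-Solver.solve-∀
    regroup : ∀ t a x b y → t + ((a + x) + (b + y)) ≡ (x + (t + y)) + (a + b)
    regroup = solve-∀

  -- As `k * e` is nonnegative, one run of `path k` loses at most `loss` per counter. Hence `k`
  -- rounds need `k * loss` plus the cost of one run, which is linear in `k`.
  long-computation : ∀ {p e} (R : Realisable p e) → (∀ i → 0ℤ ≤ e i) → let open Realisable R in
    ∀ k v → (∀ i → k ℕ.* (loss ℕ.+ rate) ℕ.+ loss ℕ.≤ lookup v i) → Computation A (p , v) (k ℕ.* len (path k))
  long-computation {e = e} R 0≤e k v enough = rounds (path k) loss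
    (λ i → ≤-trans (subst (_≤ + k * e i) (*-zeroʳ (+ k)) (*-monoˡ-≤-nonNeg (+ k) (0≤e i))) (effect≥ k i))
    k v (λ i → ℕ.≤-trans (ℕ.+-monoʳ-≤ (k ℕ.* loss) (cost≤ k))
                 (ℕ.≤-trans (ℕ.≤-reflexive (regroup k loss rate)) (enough i)))
    where
    open Realisable R
    regroup : ∀ k a b → k ℕ.* a ℕ.+ (k ℕ.* b ℕ.+ a) ≡ k ℕ.* (a ℕ.+ b) ℕ.+ a
    regroup = ℕ-Solver.solve-∀

-- In dimension zero every configuration has size 0, so a linear bound from `n₀` on may be vacuous,
-- and termination at size 0 is contradicted instead. Otherwise quadratic length from linear size
-- contradicts the bound.
realisable-nonneg⇒¬linear : ∀ {d} (A : VASS d) {p e} → Paths.Realisable A p e → (∀ i → 0ℤ ≤ e i) →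
  Terminating A → ¬ LinearComplexity A
realisable-nonneg⇒¬linear {zero} A {p} R 0≤e terminating _ with terminating 0
... | B , bounded = ℕ.<-irrefl refl (ℕ.≤-trans long (bounded (p , []) refl _ computation))
  where
  open Paths A
  open Realisable R
  computation : Computation A (p , []) (suc B ℕ.* len (path (suc B)))
  computation = long-computation R 0≤e (suc B) [] λ ()
  long : suc B ℕ.≤ suc B ℕ.* len (path (suc B))
  long = ℕ.≤-trans (ℕ.≤-reflexive (sym (ℕ.*-identityʳ (suc B)))) (ℕ.*-monoʳ-≤ (suc B) (1≤len (path (suc B))))
realisable-nonneg⇒¬linear {suc d} A {p} R 0≤e _ (C , n₀ , bounded) = ℕ.<-irrefl refl (begin-strict
  k ℕ.* k                             ≤⟨ ℕ.*-monoʳ-≤ k (k≤len k) ⟩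
  k ℕ.* len (path k)                ≤⟨ bounded n n₀≤n (p , replicate (suc d) n) (size-replicate d n) _ computation ⟩
  C ℕ.* n                             ≡⟨ expand C k s loss ⟩
  k ℕ.* (C ℕ.* s) ℕ.+ C ℕ.* loss      ≤⟨ ℕ.+-monoʳ-≤ (k ℕ.* (C ℕ.* s)) (ℕ.m≤n*m (C ℕ.* loss) k) ⟩
  k ℕ.* (C ℕ.* s) ℕ.+ k ℕ.* (C ℕ.* loss) ≡⟨ ℕ.*-distribˡ-+ k (C ℕ.* s) (C ℕ.* loss) ⟨
  k ℕ.* b                             <⟨ ℕ.*-monoʳ-< k (ℕ.s≤s (ℕ.m≤n+m b n₀)) ⟩
  k ℕ.* k                             ∎)
  where
  open Paths A
  open Realisable R
  open ℕ.≤-Reasoning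
  s b k n : ℕ
  -- Since `k` is positive, `C * n` is at most `k * b`, so `k` above `b` gives a computation of
  -- length at least `k * k` beyond the bound. Also taking `k` above `n₀`, with `s` positive, puts
  -- `n` in the range of the bound.
  s = suc (loss ℕ.+ rate)
  b = C ℕ.* s ℕ.+ C ℕ.* loss
  k = suc (n₀ ℕ.+ b)
  n = k ℕ.* s ℕ.+ loss
  expand : ∀ C k s l → C ℕ.* (k ℕ.* s ℕ.+ l) ≡ k ℕ.* (C ℕ.* s) ℕ.+ C ℕ.* l
  expand = ℕ-Solver.solve-∀
  n₀≤n : n₀ ℕ.≤ n
  n₀≤n = begin
    n₀               ≤⟨ ℕ.m≤n⇒m≤1+n (ℕ.m≤m+n n₀ b) ⟩
    k                ≤⟨ ℕ.m≤m*n k s ⟩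
    k ℕ.* s          ≤⟨ ℕ.m≤m+n (k ℕ.* s) loss ⟩
    n                ∎
  computation : Computation A (p , replicate (suc d) n) (k ℕ.* len (path k))
  computation = long-computation R 0≤e k (replicate (suc d) n) λ i → begin
    k ℕ.* (loss ℕ.+ rate) ℕ.+ loss ≤⟨ ℕ.+-monoˡ-≤ loss (ℕ.*-monoʳ-≤ k (ℕ.n≤1+n (loss ℕ.+ rate))) ⟩
    n                              ≡⟨ lookup-replicate i n ⟨
    lookup (replicate (suc d) n) i ∎

-- Ranking functions bound computations

ι : ℤ → ℚ
ι z = z / 1

-- The normalisation in `_/_` does not reduce on variables, so the laws of `ι` are checked on
-- unnormalised rationals; the argument 0 of `mkℚᵘ` encodes the denominator 1.
toℚᵘ-ι : ∀ z → toℚᵘ (ι z) ℚᵘ.≃ ℚᵘ.mkℚᵘ z 0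
toℚᵘ-ι z = ℚ.toℚᵘ-fromℚᵘ (ℚᵘ.mkℚᵘ z 0)

ι-+ : ∀ a b → ι (a ℤ.+ b) ≡ ι a ℚ.+ ι b
ι-+ a b = ℚ.toℚᵘ-injective (begin-equality
  toℚᵘ (ι (a ℤ.+ b))              ≃⟨ toℚᵘ-ι (a ℤ.+ b) ⟩
  ℚᵘ.mkℚᵘ (a ℤ.+ b) 0             ≃⟨ ℚᵘ.*≡* (unit a b) ⟩
  ℚᵘ.mkℚᵘ a 0 ℚᵘ.+ ℚᵘ.mkℚᵘ b 0    ≃⟨ ℚᵘ.+-cong (toℚᵘ-ι a) (toℚᵘ-ι b) ⟨
  toℚᵘ (ι a) ℚᵘ.+ toℚᵘ (ι b)      ≃⟨ ℚ.toℚᵘ-homo-+ (ι a) (ι b) ⟨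
  toℚᵘ (ι a ℚ.+ ι b)              ∎)
  where
  open ℚᵘ.≤-Reasoning
  unit : ∀ a b → (a ℤ.+ b) ℤ.* 1ℤ ≡ (a ℤ.* 1ℤ ℤ.+ b ℤ.* 1ℤ) ℤ.* 1ℤ
  unit = solve-∀

ι-* : ∀ a b → ι (a ℤ.* b) ≡ ι a ℚ.* ι b
ι-* a b = ℚ.toℚᵘ-injective (begin-equality
  toℚᵘ (ι (a ℤ.* b))              ≃⟨ toℚᵘ-ι (a ℤ.* b) ⟩
  ℚᵘ.mkℚᵘ a 0 ℚᵘ.* ℚᵘ.mkℚᵘ b 0    ≃⟨ ℚᵘ.*-cong (toℚᵘ-ι a) (toℚᵘ-ι b) ⟨
  toℚᵘ (ι a) ℚᵘ.* toℚᵘ (ι b)      ≃⟨ ℚ.toℚᵘ-homo-* (ι a) (ι b) ⟨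
  toℚᵘ (ι a ℚ.* ι b)              ∎)
  where open ℚᵘ.≤-Reasoning

ι-mono-≤ : ∀ {a b} → a ℤ.≤ b → ι a ℚ.≤ ι b
ι-mono-≤ {a} {b} a≤b = ℚ.toℚᵘ-cancel-≤ (begin
  toℚᵘ (ι a)     ≃⟨ toℚᵘ-ι a ⟩
  ℚᵘ.mkℚᵘ a 0    ≤⟨ ℚᵘ.*≤* (ℤ.*-monoʳ-≤-nonNeg 1ℤ a≤b) ⟩
  ℚᵘ.mkℚᵘ b 0    ≃⟨ toℚᵘ-ι b ⟨
  toℚᵘ (ι b)     ∎)
  where open ℚᵘ.≤-Reasoning

ι-cancel-≤ : ∀ {a b} → ι a ℚ.≤ ι b → a ℤ.≤ b
ι-cancel-≤ {a} {b} le = ℤ.*-cancelʳ-≤-pos a b 1ℤ (ℚᵘ.drop-*≤* (begin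
  ℚᵘ.mkℚᵘ a 0    ≃⟨ toℚᵘ-ι a ⟨
  toℚᵘ (ι a)     ≤⟨ ℚ.toℚᵘ-mono-≤ le ⟩
  toℚᵘ (ι b)     ≃⟨ toℚᵘ-ι b ⟩
  ℚᵘ.mkℚᵘ b 0    ∎))
  where open ℚᵘ.≤-Reasoning

0≤ι : ∀ n → 0ℚ ℚ.≤ ι (+ n)
0≤ι n = ι-mono-≤ {0ℤ} {+ n} (+≤+ ℕ.z≤n)

-- The denominator is at least 1, so the absolute numerator serves as a crude natural bound in place
-- of a ceiling.
p≤ι∣↥p∣ : ∀ p → p ℚ.≤ ι (+ ∣ ↥ p ∣)
p≤ι∣↥p∣ p@(ℚ.mkℚ n d _) = ℚ.toℚᵘ-cancel-≤ (begin
  ℚᵘ.mkℚᵘ n d             ≤⟨ ℚᵘ.*≤* (i≤∣i∣*[1+d] n) ⟩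
  ℚᵘ.mkℚᵘ (+ ∣ n ∣) 0     ≃⟨ toℚᵘ-ι (+ ∣ n ∣) ⟨
  toℚᵘ (ι (+ ∣ n ∣))      ∎)
  where
  open ℚᵘ.≤-Reasoning
  i≤∣i∣*[1+d] : ∀ i → i ℤ.* 1ℤ ℤ.≤ + ∣ i ∣ ℤ.* + suc d
  i≤∣i∣*[1+d] (+ m)    = ℤ.*-monoˡ-≤-nonNeg (+ m) (+≤+ (ℕ.s≤s ℕ.z≤n))
  i≤∣i∣*[1+d] -[1+ m ] = -≤+

0≤p+ι∣↥-p∣ : ∀ p → 0ℚ ℚ.≤ p ℚ.+ ι (+ ∣ ↥ (ℚ.- p) ∣)
0≤p+ι∣↥-p∣ p = begin
  0ℚ                              ≡⟨ ℚ.+-inverseʳ p ⟨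
  p ℚ.+ ℚ.- p                     ≤⟨ ℚ.+-monoʳ-≤ p (p≤ι∣↥p∣ (ℚ.- p)) ⟩
  p ℚ.+ ι (+ ∣ ↥ (ℚ.- p) ∣)       ∎
  where open ℚ.≤-Reasoning

bounded : ∀ {k} (f : Fin k → ℕ) → ∃[ B ] (∀ i → f i ℕ.≤ B)
bounded {zero}  f = 0 , λ ()
bounded {suc k} f with bounded (f ∘ suc)
... | B , f≤B = f zero ⊔ B , λ { zero → ℕ.m≤m⊔n (f zero) B ; (suc i) → ℕ.≤-trans (f≤B i) (ℕ.m≤n⊔m (f zero) B) }

maxEntry : ∀ {d} → Vec ℕ d → ℕ
maxEntry = foldr _ _⊔_ 0

dotℤ-nonneg : ∀ {d} {c : Vec ℚ d} → VecAll.All (0ℚ ℚ.≤_) c → ∀ v → 0ℚ ℚ.≤ dotℤ c (toℤVec v)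
dotℤ-nonneg []               []      = ℚ.≤-refl
dotℤ-nonneg {c = c ∷ cs} (0≤c ∷ 0≤cs) (x ∷ v) = begin
  0ℚ                                          ≡⟨ ℚ.*-zeroʳ c ⟨
  c ℚ.* 0ℚ                                    ≤⟨ ℚ.*-monoˡ-≤-nonNeg c {{ℚ.nonNegative 0≤c}} (0≤ι x) ⟩
  c ℚ.* ι (+ x)                               ≡⟨ ℚ.+-identityʳ _ ⟨
  c ℚ.* ι (+ x) ℚ.+ 0ℚ                        ≤⟨ ℚ.+-monoʳ-≤ (c ℚ.* ι (+ x)) (dotℤ-nonneg 0≤cs v) ⟩
  c ℚ.* ι (+ x) ℚ.+ dotℤ cs (toℤVec v)         ∎
  where open ℚ.≤-Reasoning

dotℤ-upper : ∀ {d} (c : Vec ℚ d) → ∃[ K ] (∀ v → dotℤ c (toℤVec v) ℚ.≤ ι (+ (K ℕ.* maxEntry v)))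
dotℤ-upper []      = 0 , λ { [] → ℚ.≤-refl }
dotℤ-upper (c ∷ cs) with dotℤ-upper cs
... | K , upper = N ℕ.+ K , λ { (x ∷ v) → let m = maxEntry v in begin
    c ℚ.* ι (+ x) ℚ.+ dotℤ cs (toℤVec v)
      ≤⟨ ℚ.+-mono-≤ (ℚ.*-monoʳ-≤-nonNeg (ι (+ x)) {{ℚ.nonNegative (0≤ι x)}} (p≤ι∣↥p∣ c)) (upper v) ⟩
    ι (+ N) ℚ.* ι (+ x) ℚ.+ ι (+ (K ℕ.* m))
      ≡⟨ cong (ℚ._+ ι (+ (K ℕ.* m))) (≡-trans (cong ι (ℤ.pos-* N x)) (ι-* (+ N) (+ x))) ⟨
    ι (+ (N ℕ.* x)) ℚ.+ ι (+ (K ℕ.* m))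
      ≡⟨ ι-+ (+ (N ℕ.* x)) (+ (K ℕ.* m)) ⟨
    ι (+ (N ℕ.* x ℕ.+ K ℕ.* m))
      ≤⟨ ι-mono-≤ (+≤+ (ℕ.+-mono-≤ (ℕ.*-monoʳ-≤ N (ℕ.m≤m⊔n x m)) (ℕ.*-monoʳ-≤ K (ℕ.m≤n⊔m x m)))) ⟩
    ι (+ (N ℕ.* (x ⊔ m) ℕ.+ K ℕ.* (x ⊔ m)))
      ≡⟨ cong (λ z → ι (+ z)) (ℕ.*-distribʳ-+ (x ⊔ m) N K) ⟨
    ι (+ ((N ℕ.+ K) ℕ.* (x ⊔ m))) ∎ }
  where
  open ℚ.≤-Reasoning
  N = ∣ ↥ c ∣

dotℤ-+ : ∀ {d} (c : Vec ℚ d) u v → dotℤ c (zipWith ℤ._+_ u v) ≡ dotℤ c u ℚ.+ dotℤ c v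
dotℤ-+ []       []      []      = refl
dotℤ-+ (c ∷ cs) (x ∷ u) (y ∷ v) = begin
  c ℚ.* ι (x ℤ.+ y) ℚ.+ dotℤ cs (zipWith ℤ._+_ u v)
    ≡⟨ cong₂ (λ s t → c ℚ.* s ℚ.+ t) (ι-+ x y) (dotℤ-+ cs u v) ⟩
  c ℚ.* (ι x ℚ.+ ι y) ℚ.+ (dotℤ cs u ℚ.+ dotℤ cs v)
    ≡⟨ distribute c (ι x) (ι y) (dotℤ cs u) (dotℤ cs v) ⟩
  (c ℚ.* ι x ℚ.+ dotℤ cs u) ℚ.+ (c ℚ.* ι y ℚ.+ dotℤ cs v) ∎
  where
  open ≡-Reasoning
  open +-*-Solver
  distribute : ∀ c x y s t → c ℚ.* (x ℚ.+ y) ℚ.+ (s ℚ.+ t) ≡ (c ℚ.* x ℚ.+ s) ℚ.+ (c ℚ.* y ℚ.+ t)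
  distribute = solve 5 (λ c x y s t → c :* (x :+ y) :+ (s :+ t) := (c :* x :+ s) :+ (c :* y :+ t)) refl

module _ {d} (A : VASS d) (f : LinearMap A) (ranking : IsRankingFunction A f) where

  rank : Config A → ℚ
  rank (p , v) = dotℤ (normal f) (toℤVec v) ℚ.+ weight f p

  rank-decreases : ∀ {c c′} → Step A c c′ → rank c′ ℚ.+ 1ℚ ℚ.≤ rank c
  rank-decreases {p , v} {q , v′} (u , t∈ , eq) = begin
    dotℤ (normal f) (toℤVec v′) ℚ.+ weight f q ℚ.+ 1ℚ
      ≡⟨ cong (λ z → z ℚ.+ weight f q ℚ.+ 1ℚ) (≡-trans (cong (dotℤ (normal f)) eq) (dotℤ-+ (normal f) (toℤVec v) u)) ⟩
    dotℤ (normal f) (toℤVec v) ℚ.+ dotℤ (normal f) u ℚ.+ weight f q ℚ.+ 1ℚ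
      ≡⟨ regroup (dotℤ (normal f) (toℤVec v)) (dotℤ (normal f) u) (weight f q) 1ℚ ⟩
    dotℤ (normal f) (toℤVec v) ℚ.+ (dotℤ (normal f) u ℚ.+ weight f q ℚ.+ 1ℚ)
      ≤⟨ ℚ.+-monoʳ-≤ (dotℤ (normal f) (toℤVec v)) (ℚ.+-monoˡ-≤ 1ℚ (proj₂ ranking _ t∈)) ⟩
    dotℤ (normal f) (toℤVec v) ℚ.+ (weight f p ℚ.- 1ℚ ℚ.+ 1ℚ)
      ≡⟨ cong (λ z → dotℤ (normal f) (toℤVec v) ℚ.+ z) (undo (weight f p) 1ℚ) ⟩
    dotℤ (normal f) (toℤVec v) ℚ.+ weight f p ∎
    where
    open ℚ.≤-Reasoning
    open +-*-Solver
    regroup : ∀ a b c e → a ℚ.+ b ℚ.+ c ℚ.+ e ≡ a ℚ.+ (b ℚ.+ c ℚ.+ e)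
    regroup = solve 4 (λ a b c e → a :+ b :+ c :+ e := a :+ (b :+ c :+ e)) refl
    undo : ∀ a b → a ℚ.- b ℚ.+ b ≡ a
    undo = solve 2 (λ a b → a :- b :+ b := a) refl

  weight-bounds : ∃[ B ] (∀ p → (weight f p ℚ.≤ ι (+ B)) × (0ℚ ℚ.≤ weight f p ℚ.+ ι (+ B)))
  weight-bounds with bounded (λ p → ∣ ↥ weight f p ∣ ⊔ ∣ ↥ (ℚ.- weight f p) ∣)
  ... | B , ≤B = B , λ p →
      ℚ.≤-trans (p≤ι∣↥p∣ (weight f p)) (ι-mono-≤ (+≤+ (ℕ.≤-trans (ℕ.m≤m⊔n ∣ ↥ weight f p ∣ _) (≤B p))))
    , ℚ.≤-trans (0≤p+ι∣↥-p∣ (weight f p))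
        (ℚ.+-monoʳ-≤ (weight f p) (ι-mono-≤ (+≤+ (ℕ.≤-trans (ℕ.m≤n⊔m ∣ ↥ weight f p ∣ _) (≤B p)))))

  -- The rank drops by at least 1 per step and ends at `- B` or above: the normal and the counters
  -- are nonnegative, so only the weight can be negative.
  length≤rank : ∀ B → (∀ p → 0ℚ ℚ.≤ weight f p ℚ.+ ι (+ B)) →
    ∀ {c n} → Computation A c n → ι (+ n) ℚ.≤ rank c ℚ.+ ι (+ B)
  length≤rank B 0≤w+B (done (p , v)) = begin
    0ℚ ℚ.+ 0ℚ ≤⟨ ℚ.+-mono-≤ (dotℤ-nonneg (proj₁ ranking) v) (0≤w+B p) ⟩
    dotℤ (normal f) (toℤVec v) ℚ.+ (weight f p ℚ.+ ι (+ B))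
      ≡⟨ ℚ.+-assoc (dotℤ (normal f) (toℤVec v)) (weight f p) (ι (+ B)) ⟨
    rank (p , v) ℚ.+ ι (+ B) ∎
    where open ℚ.≤-Reasoning
  length≤rank B 0≤w+B (step {c} {c′} {n} s computation) = begin
    ι (+ suc n)                 ≡⟨ ι-+ 1ℤ (+ n) ⟩
    1ℚ ℚ.+ ι (+ n)              ≤⟨ ℚ.+-monoʳ-≤ 1ℚ (length≤rank B 0≤w+B computation) ⟩
    1ℚ ℚ.+ (rank c′ ℚ.+ ι (+ B)) ≡⟨ ℚ.+-assoc 1ℚ (rank c′) (ι (+ B)) ⟨
    1ℚ ℚ.+ rank c′ ℚ.+ ι (+ B)  ≡⟨ cong (ℚ._+ ι (+ B)) (ℚ.+-comm 1ℚ (rank c′)) ⟩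
    rank c′ ℚ.+ 1ℚ ℚ.+ ι (+ B)  ≤⟨ ℚ.+-monoˡ-≤ (ι (+ B)) (rank-decreases s) ⟩
    rank c ℚ.+ ι (+ B)          ∎
    where open ℚ.≤-Reasoning

  affine-bound : ∃₂ λ K B → ∀ n → TermComplexityBoundedBy A n (K ℕ.* n ℕ.+ B)
  affine-bound with dotℤ-upper (normal f) | weight-bounds
  -- One `B` bounds the initial weight from above, the other the final weight from below.
  ... | K , upper | B , bounds = K , B ℕ.+ B , λ { _ (p , v) refl n computation → ℤ.drop‿+≤+ (ι-cancel-≤ (begin
    ι (+ n)
      ≤⟨ length≤rank B (proj₂ ∘ bounds) computation ⟩
    dotℤ (normal f) (toℤVec v) ℚ.+ weight f p ℚ.+ ι (+ B)
      ≤⟨ ℚ.+-monoˡ-≤ (ι (+ B)) (ℚ.+-mono-≤ (upper v) (proj₁ (bounds p))) ⟩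
    ι (+ (K ℕ.* maxEntry v)) ℚ.+ ι (+ B) ℚ.+ ι (+ B)
      ≡⟨ ℚ.+-assoc (ι (+ (K ℕ.* maxEntry v))) (ι (+ B)) (ι (+ B)) ⟩
    ι (+ (K ℕ.* maxEntry v)) ℚ.+ (ι (+ B) ℚ.+ ι (+ B))
      ≡⟨ cong (λ z → ι (+ (K ℕ.* maxEntry v)) ℚ.+ z) (ι-+ (+ B) (+ B)) ⟨
    ι (+ (K ℕ.* maxEntry v)) ℚ.+ ι (+ (B ℕ.+ B))
      ≡⟨ ι-+ (+ (K ℕ.* maxEntry v)) (+ (B ℕ.+ B)) ⟨
    ι (+ (K ℕ.* maxEntry v ℕ.+ (B ℕ.+ B))) ∎)) }
    where open ℚ.≤-Reasoning

  ranking⇒terminating : Terminating A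
  ranking⇒terminating n with affine-bound
  ... | K , B , bound = K ℕ.* n ℕ.+ B , bound n

  ranking⇒linear : LinearComplexity A
  ranking⇒linear with affine-bound
  -- From size 1 on, the constant `B` is absorbed by `B * n`.
  ... | K , B , bound = K ℕ.+ B , 1 , λ { n@(suc _) _ c c≡n m computation → begin
    m                      ≤⟨ bound n c c≡n m computation ⟩
    K ℕ.* n ℕ.+ B          ≤⟨ ℕ.+-monoʳ-≤ (K ℕ.* n) (ℕ.m≤m*n B n) ⟩
    K ℕ.* n ℕ.+ B ℕ.* n    ≡⟨ ℕ.*-distribʳ-+ n K B ⟨
    (K ℕ.+ B) ℕ.* n        ∎ }
    where open ℕ.≤-Reasoning

-- Ranking functions from linear complexity

dotℤ-ι : ∀ {d} (c : Vec ℕ d) u → dotℤ (Vec.map (ι ∘ +_) c) u ≡ ι (dot c (lookup u))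
dotℤ-ι []       []      = refl
dotℤ-ι (c ∷ cs) (x ∷ u) = sym (begin
  ι (+ c * x + dot cs (lookup u))            ≡⟨ ι-+ (+ c * x) (dot cs (lookup u)) ⟩
  ι (+ c * x) ℚ.+ ι (dot cs (lookup u))      ≡⟨ cong₂ ℚ._+_ (ι-* (+ c) x) (sym (dotℤ-ι cs u)) ⟩
  ι (+ c) ℚ.* ι x ℚ.+ dotℤ (Vec.map (ι ∘ +_) cs) u ∎)
  where open ≡-Reasoning

map-ι-nonneg : ∀ {d} (c : Vec ℕ d) → VecAll.All (0ℚ ℚ.≤_) (Vec.map (ι ∘ +_) c)
map-ι-nonneg []       = []
map-ι-nonneg (c ∷ cs) = 0≤ι c ∷ map-ι-nonneg cs

module _ {d} (A : VASS d) where

  open Paths A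

  edges : ∀ ts → (∀ {t} → t ∈ ts → t ∈ trans A) → ∀ p q → List (Path A p q)
  edges []               ⊆A p q = []
  edges ((p′ , u , q′) ∷ ts) ⊆A p q with p ≟ p′ | q ≟ q′
  ... | yes refl | yes refl = edge (⊆A (here refl)) ∷ edges ts (⊆A ∘ there) p q
  ... | _        | _        = edges ts (⊆A ∘ there) p q

  edge∈edges : ∀ ts (⊆A : ∀ {t} → t ∈ ts → t ∈ trans A) {p u q} (t∈ : (p , u , q) ∈ ts) →
    edge (⊆A t∈) ∈ edges ts ⊆A p q
  edge∈edges ((p′ , u′ , q′) ∷ ts) ⊆A {p} {u} {q} t∈ with p ≟ p′ | q ≟ q′ | t∈
  ... | yes refl | yes refl | here refl = here refl
  ... | yes refl | yes refl | there t∈′ = there (edge∈edges ts (⊆A ∘ there) t∈′)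
  ... | yes refl | no q≢q   | here refl = contradiction refl q≢q
  ... | yes refl | no _     | there t∈′ = edge∈edges ts (⊆A ∘ there) t∈′
  ... | no p≢p   | _        | here refl = contradiction refl p≢p
  ... | no _     | _        | there t∈′ = edge∈edges ts (⊆A ∘ there) t∈′

  edgePaths : ∀ p q → List (Path A p q)
  edgePaths = edges (trans A) λ t∈ → t∈

  -- On a single transition this is `c · u + 1`, so a potential for `drift c` is a weight function
  -- that ranks every transition.
  drift : Vec ℕ d → ∀ {p q} → Path A p q → ℤ
  drift c π = dot c (effect π) + + len π

  drift-⊕ : ∀ c {p q r} (π : Path A p q) (σ : Path A q r) → drift c (π ⊕ σ) ≡ drift c π + drift c σ
  drift-⊕ c π σ = begin
    dot c (effect (π ⊕ σ)) + + len (π ⊕ σ)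
      ≡⟨ cong₂ _+_ (dot-cong c λ i → ≡-trans (effect-⊕ π σ i) (unit (effect π i) (effect σ i)))
                   (cong +_ (len-⊕ π σ)) ⟩
    dot c (λ i → 1ℤ * effect π i + 1ℤ * effect σ i) + (+ len π + + len σ)
      ≡⟨ cong (λ z → z + (+ len π + + len σ)) (dot-linear c 1ℤ 1ℤ (effect π) (effect σ)) ⟩
    1ℤ * dot c (effect π) + 1ℤ * dot c (effect σ) + (+ len π + + len σ)
      ≡⟨ regroup (dot c (effect π)) (dot c (effect σ)) (+ len π) (+ len σ) ⟩
    drift c π + drift c σ ∎
    where
    open ≡-Reasoning
    unit : ∀ a b → a + b ≡ 1ℤ * a + 1ℤ * b
    unit = solve-∀
    regroup : ∀ a b m n → 1ℤ * a + 1ℤ * b + (m + n) ≡ (a + m) + (b + n)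
    regroup = solve-∀

  drift-bound⇒ranking : ∀ c → (∀ p → All (λ γ → drift c γ ≤ 0ℤ) (cycles _⊕_ edgePaths p)) →
    HasRankingFunction A
  drift-bound⇒ranking c sat with potential _⊕_ edgePaths (drift c) (drift-⊕ c) sat
  ... | w , w-sat =
    record { normal = Vec.map (ι ∘ +_) c ; weight = ι ∘ w } , map-ι-nonneg c , ranked
    where
    ranked : ∀ t → t ∈ trans A → Ranked {A = A} (record { normal = Vec.map (ι ∘ +_) c ; weight = ι ∘ w }) t
    ranked (p , u , q) t∈ = begin
      dotℤ (Vec.map (ι ∘ +_) c) u ℚ.+ ι (w q) ≡⟨ cong (ℚ._+ ι (w q)) (dotℤ-ι c u) ⟩
      ι (dot c (lookup u)) ℚ.+ ι (w q)        ≡⟨ ι-+ (dot c (lookup u)) (w q) ⟨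
      ι (dot c (lookup u) + w q)              ≤⟨ ι-mono-≤ decrease ⟩
      ι (w p - 1ℤ)                            ≡⟨ ι-+ (w p) (- 1ℤ) ⟩
      ι (w p) ℚ.- 1ℚ                          ∎
      where
      open ℚ.≤-Reasoning
      shift : ∀ a b → a + b ≡ b + (a + 1ℤ) - 1ℤ
      shift = solve-∀
      decrease : dot c (lookup u) + w q ≤ w p - 1ℤ
      decrease = ≤-trans (≤-reflexive (shift (dot c (lookup u)) (w q)))
        (+-monoˡ-≤ (- 1ℤ) (All.lookup (w-sat p q) (edge∈edges (trans A) (λ t∈′ → t∈′) t∈)))

  -- The constant is carried along formally instead of being read off a realising path, since
  -- `const-combine` is an exact equation and connecting paths would spoil it. Fixing `p` makes all
  -- realising paths composable.
  pathCone : State A → Cone d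
  pathCone p = record
    { Row           = Σ (Fin d → ℤ) (Realisable p) × ℕ
    ; coeff         = λ ((e , _) , _) → e
    ; const         = proj₂
    ; combine       = λ m n ((_ , R) , a) ((_ , S) , b) →
                        (_ , realisable-combine m n R S) , suc m ℕ.* a ℕ.+ n ℕ.* b
    ; coeff-combine = λ _ _ _ _ _ → refl
    ; const-combine = λ _ _ _ _ → refl
    }

  linear⇒ranking : StronglyConnected A → Terminating A → LinearComplexity A → HasRankingFunction A
  linear⇒ranking connected terminating linear = conclude (farkas (pathCone p₀) (concat (tabulate rows)))
    where
    p₀ : State A
    p₀ = fromℕ< (nonempty A)

    open Cone (pathCone p₀)

    -- Strong connectivity supplies the paths from `p₀` to the cycle and back. With `len γ` as
    -- constant, `value c (row γ)` unfolds to `drift c γ`.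
    row : ∀ {q} → Path A q q → Row
    row γ = (effect γ , cycle-realisable (connected _ _) γ (connected _ _)) , len γ

    rows : State A → List Row
    rows q = List.map row (cycles _⊕_ edgePaths q)

    conclude : (∃[ c ] All (λ x → value c x ≤ 0ℤ) (concat (tabulate rows))) ⊎ (∃[ x ] (∀ i → 0ℤ ≤ coeff x i)) →
      HasRankingFunction A
    conclude (inj₁ (c , sat)) = drift-bound⇒ranking c λ p → All.map⁻ (All.tabulate⁻ (All.concat⁻ sat) p)
    conclude (inj₂ (((_ , R) , _) , 0≤e)) =
      contradiction linear (realisable-nonneg⇒¬linear A R 0≤e terminating)

mainTheorem1 : ∀ (d : ℕ) (A : VASS d) → StronglyConnected A →
    ((Terminating A × LinearComplexity A) ⇔ HasRankingFunction A)
mainTheorem1 d A connected = mk⇔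
  (λ (terminating , linear) → linear⇒ranking A connected terminating linear)
  (λ (f , ranking) → ranking⇒terminating A f ranking , ranking⇒linear A f ranking)
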